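{- Let $H$ be a simple cycle with at least $5$ vertices. Then $H \in \mathbf{PGR}$, i.e. there is a constant $C_H$ such that $\operatorname{gr}(H,K_k) \le k^{C_H}$ for all integers $k \ge 2$.
   Context: A grid subgraph on $c$ columns and $r$ rows is a graph $H$ whose vertex set is a subset of $[c]\times[r]$ (the vertex $(x,y)$ lies in column $x$ and row $y$) such that every edge joins two vertices in the same row (a horizontal edge) or in the same column (a vertical edge). $G_{c\times r}=K_c\square K_r$ denotes the complete grid graph on $[c]\times[r]$; a spanning grid subgraph is a spanning subgraph of $G_{c\times r}$. An embedding of a grid subgraph $H$ on $c_H$ columns and $r_H$ rows into a grid subgraph $G$ on $c_G$ columns and $r_G$ rows is a pair of injections $\varphi_c:[c_H]\to[c_G]$, $\varphi_r:[r_H]\to[r_G]$ such that for every edge $\{(x,y),(x',y')\}$ of $H$, $\{(\varphi_c(x),\varphi_r(y)),(\varphi_c(x'),\varphi_r(y'))\}$ is an edge of $G$; $G$ contains $H$ if such an embedding exists. A coclique of size $k$ in a spanning grid subgraph $G$ is a set of $k$ vertices all lying in one row or all lying in one column, no two of which are adjacent in $G$. The grid Ramsey number $\operatorname{gr}(H,K_k)$ is the least $N$ such that every spanning grid subgraph of $G_{N\times N}$ contains $H$ or contains a coclique of size $k$. $\mathbf{PGR}$ is the class of grid subgraphs $H$ with $\operatorname{gr}(H,K_k)=k^{O_H(1)}$. A grid subgraph is simple if for every row and every column, the subgraph induced on its vertices lying in that row (resp. column) is connected. A simple cycle is a grid subgraph which is a cycle (as a graph) and is simple; its length is its number of vertices.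 -}

module Defs where

open import Data.Nat using (ℕ; zero; suc; _≤_; _^_)
open import Data.Fin using (Fin; toℕ)
open import Data.Bool using (Bool; true; false)
open import Data.Product using (Σ; _×_; _,_; ∃; proj₁; proj₂)
open import Data.Sum using (_⊎_)
open import Relation.Binary.PropositionalEquality using (_≡_; _≢_)
open import Relation.Nullary using (¬_)
open import Function.Definitions using (Injective)

Cell : ℕ → ℕ → Set
Cell c r = Fin c × Fin r

col : ∀ {c r} → Cell c r → Fin c
col = proj₁

row : ∀ {c r} → Cell c r → Fin r
row = proj₂

record GridSubgraph (c r : ℕ) : Set where
  field
    V      : Cell c r → Bool
    E      : Cell c r → Cell c r → Bool
    E-V    : ∀ u v → E u v ≡ true → (V u ≡ true) × (V v ≡ true)
    E-sym  : ∀ u v → E u v ≡ true → E v u ≡ true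
    E-irr  : ∀ u → E u u ≡ false
    E-grid : ∀ u v → E u v ≡ true → (row u ≡ row v) ⊎ (col u ≡ col v)
open GridSubgraph public

Spanning : ∀ {c r} → GridSubgraph c r → Set
Spanning G = ∀ u → V G u ≡ true

record Embedding {cH rH cG rG : ℕ} (H : GridSubgraph cH rH) (G : GridSubgraph cG rG) : Set where
  field
    φc     : Fin cH → Fin cG
    φr     : Fin rH → Fin rG
    φc-inj : Injective _≡_ _≡_ φc
    φr-inj : Injective _≡_ _≡_ φr
    edges  : ∀ x y x′ y′ → E H (x , y) (x′ , y′) ≡ true →
             E G (φc x , φr y) (φc x′ , φr y′) ≡ true

Contains : ∀ {cG rG cH rH} → GridSubgraph cG rG → GridSubgraph cH rH → Set
Contains G H = Embedding H G

HasCoclique : ∀ {c r} → GridSubgraph c r → ℕ → Set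
HasCoclique {c} {r} G k =
    (Σ (Fin r) λ y → Σ (Fin k → Fin c) λ f → Injective _≡_ _≡_ f ×
       (∀ i → V G (f i , y) ≡ true) ×
       (∀ i j → i ≢ j → E G (f i , y) (f j , y) ≡ false))
  ⊎ (Σ (Fin c) λ x → Σ (Fin k → Fin r) λ f → Injective _≡_ _≡_ f ×
       (∀ i → V G (x , f i) ≡ true) ×
       (∀ i j → i ≢ j → E G (x , f i) (x , f j) ≡ false))

data Reach {c r} (H : GridSubgraph c r) (P : Cell c r → Set) : Cell c r → Cell c r → Set where
  here : ∀ {u} → Reach H P u u
  step : ∀ {u v w} → E H u v ≡ true → P v → Reach H P v w → Reach H P u w

InducedConnected : ∀ {c r} → GridSubgraph c r → (Cell c r → Set) → Set
InducedConnected H P = ∀ u v → P u → P v → Reach H P u v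

InRow : ∀ {c r} → GridSubgraph c r → Fin r → Cell c r → Set
InRow H y u = (V H u ≡ true) × (row u ≡ y)

InCol : ∀ {c r} → GridSubgraph c r → Fin c → Cell c r → Set
InCol H x u = (V H u ≡ true) × (col u ≡ x)

Simple : ∀ {c r} → GridSubgraph c r → Set
Simple {c} {r} H = (∀ y → InducedConnected H (InRow H y)) × (∀ x → InducedConnected H (InCol H x))

CycSucc : (n : ℕ) → Fin n → Fin n → Set
CycSucc n i j = (suc (toℕ i) ≡ toℕ j) ⊎ ((suc (toℕ i) ≡ n) × (toℕ j ≡ 0))

IsCycle : ∀ {c r} → GridSubgraph c r → ℕ → Set
IsCycle {c} {r} H n = (3 ≤ n) × Σ (Fin n → Cell c r) λ v →
    Injective _≡_ _≡_ v
  × (∀ u → V H u ≡ true → ∃ λ i → v i ≡ u)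
  × (∀ i → V H (v i) ≡ true)
  × (∀ u w → E H u w ≡ true →
        ∃ λ i → ∃ λ j → CycSucc n i j × (((u ≡ v i) × (w ≡ v j)) ⊎ ((u ≡ v j) × (w ≡ v i))))
  × (∀ i j → CycSucc n i j → E H (v i) (v j) ≡ true)

IsSimpleCycle : ∀ {c r} → GridSubgraph c r → ℕ → Set
IsSimpleCycle H n = IsCycle H n × Simple H

-- "gr(H, K_k) ≤ M": some N ≤ M is such that every spanning grid subgraph of
-- G_{N×N} contains H or has a coclique of size k.
GrBound : ∀ {cH rH} → GridSubgraph cH rH → ℕ → ℕ → Set
GrBound H k M = Σ ℕ λ N → (N ≤ M) ×
  ((G : GridSubgraph N N) → Spanning G → Contains G H ⊎ HasCoclique G k)

InPGR : ∀ {cH rH} → GridSubgraph cH rH → Set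
InPGR H = Σ ℕ λ C → ∀ k → 2 ≤ k → GrBound H k (k ^ C)

{-# OPTIONS --safe #-}

-- Let G be a grid with no coclique of size k, so that all its row and column
-- graphs have independence number < k.  Look at M rows and N ≫ M columns, both
-- polynomial in k.  Call two columns frequent if they are joined in many rows.
-- Any k columns contain an edge of each row, hence by pigeonhole a frequent
-- pair, so some column v is frequent with many columns u.  Among the rows joining
-- v to u there is a clique K of column u with many common neighbours in column u,
-- and among these a clique Y of column v.  As M ≪ N, many columns u
-- have the same K and Y; they form a set U.
--
-- To embed the cycle H, send one of its columns x₀ to v, the rows meeting x₀
-- to Y, the other rows to K, and the other columns to U.  The only
-- edges not provided for are the horizontal ones inside U, and these form paths
-- of columns, which are found greedily.  This works unless another column
-- of H has an edge between two rows meeting x₀.  If all columns and, after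
-- transposition, all rows of H have this defect, then H is a 4-cycle.
module Submission where

open import Defs
open import Data.Bool using (Bool; true; false; if_then_else_)
import Data.Bool.Properties as Bool
open import Data.Empty using (⊥; ⊥-elim)
open import Data.Fin as Fin using (Fin; zero; suc; toℕ)
import Data.Fin.Properties as Fin
open import Data.List as List using (List; []; _∷_; length; take; allFin; filter)
open import Data.List.Membership.Propositional using (_∈_; _∉_; find)
open import Data.List.Membership.Propositional.Properties using (∈-lookup; ∈-filter⁻)
import Data.List.Properties as List
open import Data.List.Relation.Binary.Sublist.Propositional using (_⊆_; []; _∷_; _∷ʳ_; ⊆-refl; ⊆-trans; minimum)
open import Data.List.Relation.Binary.Sublist.Propositional.Properties using (All-resp-⊆; Any-resp-⊆; take-⊆; filter⁺; length-mono-≤)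
open import Data.List.Relation.Unary.All as All using (All; []; _∷_)
open import Data.List.Relation.Unary.All.Properties using (¬Any⇒All¬)
open import Data.List.Relation.Unary.AllPairs as AllPairs using (AllPairs; []; _∷_)
import Data.List.Relation.Unary.AllPairs.Properties as AllPairs
open import Data.List.Relation.Unary.Any as Any using (here; there)
open import Data.List.Relation.Unary.Any.Properties using (lookup-index)
open import Data.List.Relation.Unary.Unique.Propositional using (Unique)
open import Data.List.Relation.Unary.Unique.Propositional.Properties as Unique using (Unique[x∷xs]⇒x∉xs)
open import Data.Nat using (ℕ; zero; suc; _+_; _*_; _^_; _≤_; _<_; _≤?_; _<?_; z≤n; s≤s; NonZero; >-nonZero)
open import Data.Nat.Properties
open import Data.Product using (∃; ∃₂; _×_; _,_; proj₁; proj₂; map₁; map₂; swap)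
open import Data.Sum as Sum using (_⊎_; inj₁; inj₂; [_,_]′)
open import Data.Vec as Vec using (Vec; []; _∷_; lookup)
open import Data.Vec.Properties using (lookup∘tabulate)
open import Function using (_∘_; case_of_)
open import Function.Definitions using (Injective)
open import Level using (0ℓ)
open import Relation.Binary using (Rel; tri<; tri≈; tri>)
open import Relation.Binary.PropositionalEquality
open import Relation.Nullary using (¬_; Dec; does; yes; no; contradiction)
open import Relation.Nullary.Decidable using (_×-dec_; _→-dec_; ¬?; map′; dec-true)

private
  variable
    X : Set

-- Independence numbers

Graph : Set → Set
Graph X = X → X → Bool

Symmetric Irreflexive : Graph X → Set
Symmetric g = ∀ {a b} → g a b ≡ true → g b a ≡ true
Irreflexive g = ∀ a → g a a ≡ false

-- Distinctness is included, so that the length of the list counts vertices.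
Independent : Graph X → List X → Set
Independent g = AllPairs (λ a b → a ≢ b × g a b ≡ false)

IndependenceBelow : ℕ → Graph X → Set
IndependenceBelow k g = ∀ {l} → Independent g l → length l < k

AllPairs-resp-⊆ : ∀ {R : Rel X 0ℓ} {xs ys} → xs ⊆ ys → AllPairs R ys → AllPairs R xs
AllPairs-resp-⊆ []         []       = []
AllPairs-resp-⊆ (_ ∷ʳ s)   (_ ∷ ps) = AllPairs-resp-⊆ s ps
AllPairs-resp-⊆ (refl ∷ s) (p ∷ ps) = All-resp-⊆ s p ∷ AllPairs-resp-⊆ s ps

adjacent-distinct : ∀ {g : Graph X} → Irreflexive g → ∀ {a b} → g a b ≡ true → a ≢ b
adjacent-distinct irr {a} p refl = case trans (sym p) (irr a) of λ ()

record Split (P Q : X → Set) (l : List X) : Set where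
  field
    ls rs   : List X
    ls⊆     : ls ⊆ l
    rs⊆     : rs ⊆ l
    lengths : length ls + length rs ≡ length l
    all-ls  : All P ls
    all-rs  : All Q rs

split : ∀ {P Q : X → Set} {l} → All (λ x → P x ⊎ Q x) l → Split P Q l
split [] = record
  { ls⊆ = [] ; rs⊆ = [] ; lengths = refl ; all-ls = [] ; all-rs = [] }
split {l = x ∷ _} (inj₁ p ∷ ps) = record
  { ls⊆ = refl ∷ ls⊆ ; rs⊆ = x ∷ʳ rs⊆ ; lengths = cong suc lengths
  ; all-ls = p ∷ all-ls ; all-rs = all-rs }
  where open Split (split ps)
split {l = x ∷ _} (inj₂ q ∷ ps) = record
  { ls⊆ = x ∷ʳ ls⊆ ; rs⊆ = refl ∷ rs⊆ ; lengths = trans (+-suc _ _) (cong suc lengths)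
  ; all-ls = all-ls ; all-rs = q ∷ all-rs }
  where open Split (split ps)

true-or-false : ∀ b → b ≡ true ⊎ b ≡ false
true-or-false true  = inj₁ refl
true-or-false false = inj₂ refl

-- Greedy choice: unless the head has `m` neighbours in the tail, it goes into `I` and its
-- neighbours are discarded. The head and its fewer than `m` neighbours cost at most `m` entries, so
-- there are `j` rounds. With `1 ≤ m` the list cannot run out before the last round.
independent-or-degree : (g : Graph X) (j m : ℕ) {l : List X} → 1 ≤ m → Unique l → j * m ≤ length l →
  (∃₂ λ v l′ → v ∈ l × l′ ⊆ l × m ≤ length l′ × All (λ u → g v u ≡ true) l′)
  ⊎ (∃ λ I → j ≤ length I × I ⊆ l × Independent g I)
independent-or-degree g zero m {l} 1≤m _ _ = inj₂ ([] , z≤n , minimum l , [])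
independent-or-degree g (suc j) m {[]} 1≤m _ le =
  contradiction (≤-trans (≤-trans 1≤m (m≤m+n m (j * m))) le) λ ()
independent-or-degree g (suc j) m {x ∷ l} 1≤m (x≢ ∷ unique) le with split (All.universal (true-or-false ∘ g x) l)
... | s with m ≤? length (Split.ls s)
...   | yes large = inj₁ (x , ls , here refl , x ∷ʳ ls⊆ , large , all-ls)
  where open Split s
...   | no small
  with independent-or-degree g j m 1≤m (AllPairs-resp-⊆ (Split.rs⊆ s) unique) rest
  where
  open Split s
  open ≤-Reasoning
  rest : j * m ≤ length rs
  rest = +-cancelˡ-≤ m _ _ (begin
    m + j * m                          ≤⟨ le ⟩
    suc (length l)                     ≡⟨ cong suc lengths ⟨
    suc (length ls) + length rs ≤⟨ +-monoˡ-≤ _ (≰⇒> small) ⟩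
    m + length rs                  ∎)
...     | inj₁ (v , l′ , v∈ , l′⊆ , rest) =
  inj₁ (v , l′ , there (Any-resp-⊆ rs⊆ v∈) , x ∷ʳ ⊆-trans l′⊆ rs⊆ , rest)
  where open Split s
...     | inj₂ (I , j≤ , I⊆ , indep) = inj₂
  ( x ∷ I , s≤s j≤ , refl ∷ ⊆-trans I⊆ rs⊆
  , All.zip (All-resp-⊆ (⊆-trans I⊆ rs⊆) x≢ , All-resp-⊆ I⊆ all-rs) ∷ indep)
  where open Split s

high-degree : ∀ {k} {g : Graph X} → IndependenceBelow k g → ∀ m {l} → 1 ≤ m → Unique l → k * m ≤ length l →
  ∃₂ λ v l′ → v ∈ l × l′ ⊆ l × m ≤ length l′ × All (λ u → g v u ≡ true) l′
high-degree {k = k} {g} α<k m 1≤m unique le with independent-or-degree g k m 1≤m unique le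
... | inj₁ found = found
... | inj₂ (_ , k≤ , _ , indep) = contradiction k≤ (<⇒≱ (α<k indep))

IsClique : ∀ {t} → Graph X → Vec X t → Set
IsClique g K = ∀ i j → i ≢ j → g (lookup K i) (lookup K j) ≡ true

-- A vertex of high degree is taken and the search continues among its neighbours. Each of the `t`
-- rounds shrinks the list by a factor `k`.
clique-with-neighbours : ∀ {k} {g : Graph X} → IndependenceBelow k g → 1 ≤ k → Symmetric g →
  ∀ t m {l} → 1 ≤ m → Unique l → k ^ t * m ≤ length l →
  ∃₂ λ (K : Vec X t) l′ → IsClique g K × (∀ i → lookup K i ∈ l) × l′ ⊆ l × m ≤ length l′
    × (∀ {u} → u ∈ l′ → ∀ i → g (lookup K i) u ≡ true)
clique-with-neighbours _ _ _ zero m _ _ le =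
  [] , _ , (λ ()) , (λ ()) , ⊆-refl , ≤-trans (≤-reflexive (sym (+-identityʳ m))) le , (λ _ ())
clique-with-neighbours {X} {k = k} {g} α<k 1≤k g-sym (suc t) m 1≤m unique le
  with high-degree α<k (k ^ t * m) (*-mono-≤ (m^n>0 k {{>-nonZero 1≤k}} t) 1≤m) unique
         (≤-trans (≤-reflexive (sym (*-assoc k _ m))) le)
... | v , l₁ , v∈ , l₁⊆ , le₁ , v-l₁
  with clique-with-neighbours α<k 1≤k g-sym t m 1≤m (AllPairs-resp-⊆ l₁⊆ unique) le₁
...   | K , l₂ , K-clique , K∈ , l₂⊆ , le₂ , K-l₂ =
  v ∷ K , l₂ , clique , (λ { zero → v∈ ; (suc i) → Any-resp-⊆ l₁⊆ (K∈ i) }) , ⊆-trans l₂⊆ l₁⊆ , le₂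
  , λ { u∈ zero → All.lookup v-l₁ (Any-resp-⊆ l₂⊆ u∈) ; u∈ (suc i) → K-l₂ u∈ i }
  where
  clique : IsClique g (v ∷ K)
  clique zero    zero    i≢j = contradiction refl i≢j
  clique zero    (suc j) _   = All.lookup v-l₁ (K∈ j)
  clique (suc i) zero    _   = g-sym (All.lookup v-l₁ (K∈ i))
  clique (suc i) (suc j) i≢j = K-clique i j (i≢j ∘ cong suc)

record MaximalIndependent (g : Graph X) (l : List X) : Set where
  field
    I A         : List X
    I⊆          : I ⊆ l
    A⊆          : A ⊆ l
    lengths     : length I + length A ≡ length l
    independent : Independent g I
    disjoint    : ∀ {b} → b ∈ I → b ∉ A
    dominated   : ∀ {a} → a ∈ A → ∃ λ b → b ∈ I × g a b ≡ true

-- Going through the list from its end, an entry joins `I` if it has no neighbour there yet;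
-- otherwise that neighbour dominates it and it goes to the complement `A`.
maximalIndependent : (g : Graph X) {l : List X} → Unique l → MaximalIndependent g l
maximalIndependent g {[]} _ = record
  { I⊆ = [] ; A⊆ = [] ; lengths = refl ; independent = [] ; disjoint = λ () ; dominated = λ () }
maximalIndependent g {x ∷ l} (x≢ ∷ unique) with maximalIndependent g unique
... | M with Any.any? (λ b → g x b Bool.≟ true) (MaximalIndependent.I M)
...   | yes p = record
  { I⊆ = x ∷ʳ I⊆ ; A⊆ = refl ∷ A⊆ ; lengths = trans (+-suc _ _) (cong suc lengths)
  ; independent = independent
  ; disjoint = λ { b∈ (here refl) → All.lookup x≢ (Any-resp-⊆ I⊆ b∈) refl ; b∈ (there b∈A) → disjoint b∈ b∈A }
  ; dominated = λ { (here refl) → find p ; (there a∈) → dominated a∈ } }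
  where
  open MaximalIndependent M
...   | no ¬p = record
  { I⊆ = refl ∷ I⊆ ; A⊆ = x ∷ʳ A⊆ ; lengths = cong suc lengths
  ; independent = All.zip (All-resp-⊆ I⊆ x≢ , All.map (Bool.¬-not) (¬Any⇒All¬ I ¬p)) ∷ independent
  ; disjoint = λ { (here refl) b∈A → All.lookup x≢ (Any-resp-⊆ A⊆ b∈A) refl ; (there b∈) → disjoint b∈ }
  ; dominated = λ a∈ → map₂ (map₁ there) (dominated a∈) }
  where
  open MaximalIndependent M

-- Pigeonhole

-- Either the box `zero` holds more than `q` entries, or dropping it loses at most `q`. Labels are
-- given by a relation, so that the evidence for the chosen label survives in the conclusion.
pigeonhole-Fin : ∀ m q {P : X → Fin m → Set} {l} → All (∃ ∘ P) l → m * q < length l →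
  ∃₂ λ b l′ → l′ ⊆ l × q < length l′ × All (λ x → P x b) l′
pigeonhole-Fin zero q ((() , _) ∷ _)
pigeonhole-Fin (suc m) q {P} {l} labels lt with split (All.map zero-or-suc labels)
  where
  zero-or-suc : ∀ {x} → ∃ (P x) → P x zero ⊎ ∃ (P x ∘ suc)
  zero-or-suc (zero  , p) = inj₁ p
  zero-or-suc (suc b , p) = inj₂ (b , p)
... | s with suc q ≤? length (Split.ls s)
...   | yes large = zero , ls , ls⊆ , large , all-ls
  where open Split s
...   | no small = let b , l′ , l′⊆ , q< , all = pigeonhole-Fin m q all-rs rest in
                   suc b , l′ , ⊆-trans l′⊆ rs⊆ , q< , all
  where
  open Split s
  open ≤-Reasoning
  rest : m * q < length rs
  rest = +-cancelˡ-< q _ _ (begin-strict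
    q + m * q             <⟨ lt ⟩
    length l              ≡⟨ lengths ⟨
    length ls + length rs ≤⟨ +-monoˡ-≤ _ (≮⇒≥ small) ⟩
    q + length rs         ∎)

pigeonhole-Vec : ∀ m n q {P : X → Vec (Fin m) n → Set} {l} → All (∃ ∘ P) l → m ^ n * q < length l →
  ∃₂ λ bs l′ → l′ ⊆ l × q < length l′ × All (λ x → P x bs) l′
pigeonhole-Vec m zero q labels lt =
  [] , _ , ⊆-refl , ≤-trans (s≤s (≤-reflexive (sym (+-identityʳ q)))) lt , All.map (λ { ([] , p) → p }) labels
pigeonhole-Vec m (suc n) q {P} labels lt =
  let b , l₁ , l₁⊆ , lt₁ , labels₁ =
        pigeonhole-Fin m (m ^ n * q) {λ x b → ∃ λ bs → P x (b ∷ bs)}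
          (All.map (λ { (b ∷ bs , p) → b , bs , p }) labels)
          (≤-trans (s≤s (≤-reflexive (sym (*-assoc m _ q)))) lt)
      bs , l₂ , l₂⊆ , lt₂ , all = pigeonhole-Vec m n q labels₁ lt₁
  in b ∷ bs , l₂ , ⊆-trans l₂⊆ l₁⊆ , lt₂ , all

-- Frequent pairs of columns

-- Positions rather than entries are returned: pairs of positions are few and serve as pigeonhole
-- labels.
adjacent-positions : (g : Graph X) (l : List X) →
  AllPairs (λ a b → g a b ≡ false) l
  ⊎ (∃₂ λ i j → i Fin.< j × g (List.lookup l i) (List.lookup l j) ≡ true)
adjacent-positions g [] = inj₁ []
adjacent-positions g (x ∷ l) with Any.any? (λ b → g x b Bool.≟ true) l
... | yes p = inj₂ (zero , suc (Any.index p) , s≤s z≤n , lookup-index p)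
... | no ¬p with adjacent-positions g l
...   | inj₁ none = inj₁ (All.map Bool.¬-not (¬Any⇒All¬ l ¬p) ∷ none)
...   | inj₂ (i , j , i<j , p) = inj₂ (suc i , suc j , s≤s i<j , p)

AllPairs-lookup : ∀ {R : Rel X 0ℓ} {l} → AllPairs R l → ∀ {i j} → i Fin.< j → R (List.lookup l i) (List.lookup l j)
AllPairs-lookup (p ∷ _)  {zero}  {suc j} _         = All.lookup p (∈-lookup j)
AllPairs-lookup (_ ∷ ps) {suc i} {suc j} (s≤s i<j) = AllPairs-lookup ps i<j

-- Vertical edges of the cycle will be carried by `Y` in column `v`, and by `K` and the pairs `K-Y`
-- in the columns of `U`. Nothing is claimed about pairs inside `Y` in a column of `U`; this is why
-- `x₀` has to be good.
record Skeleton {M N} (R : Fin M → Graph (Fin N)) (C : Fin N → Graph (Fin M)) (t q : ℕ) : Set where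
  field
    v    : Fin N
    Y K  : Vec (Fin M) t
    U    : List (Fin N)
    U-unique : Unique U
    U-large  : q < length U
    Y-clique : IsClique (C v) Y
    K-clique : ∀ {u} → u ∈ U → IsClique (C u) K
    K-Y      : ∀ {u} → u ∈ U → ∀ i j → C u (lookup K i) (lookup Y j) ≡ true
    Y-row    : ∀ {u} → u ∈ U → ∀ i → R (lookup Y i) v u ≡ true
    K-row    : ∀ {u} → u ∈ U → ∀ i → R (lookup K i) v u ≡ true

does-true : ∀ {P : Set} (p? : Dec P) → does p? ≡ true → P
does-true (yes p) _ = p

length-allFin : ∀ n → length (allFin n) ≡ n
length-allFin n = List.length-tabulate {n = n} (λ i → i)

module _ {M N k : ℕ} (1≤k : 1 ≤ k) (R : Fin M → Graph (Fin N)) (C : Fin N → Graph (Fin M))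
  (α-R : ∀ y → IndependenceBelow k (R y)) (α-C : ∀ x → IndependenceBelow k (C x))
  (C-sym : ∀ x → Symmetric (C x)) where

  rows : Fin N → Fin N → List (Fin M)
  rows v u = filter (λ y → R y v u Bool.≟ true) (allFin M)

  frequent : ℕ → Graph (Fin N)
  frequent d v u = does (d <? length (rows v u))

  rows-largest : ∀ {v u l} → l ⊆ allFin M → All (λ y → R y v u ≡ true) l → length l ≤ length (rows v u)
  rows-largest {v} {u} {l} l⊆ all = begin
    length l                ≡⟨ cong length (List.filter-all R? all) ⟨
    length (filter R? l)    ≤⟨ length-mono-≤ (filter⁺ R? R? (λ { refl p → p }) l⊆) ⟩
    length (rows v u)       ∎
    where
    open ≤-Reasoning
    R? = λ y → R y v u Bool.≟ true

  -- Each row has an edge inside any k columns, so some pair of these columns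
  -- is an edge of more than d rows.
  α-frequent : ∀ d → k ^ 2 * d < M → IndependenceBelow k (frequent d)
  α-frequent d lt {l} indep with length l <? k
  ... | yes l<k = l<k
  ... | no l≮k = ⊥-elim (infrequent popular)
    where
    -- Cutting down to exactly `k` columns leaves only `k ^ 2` labels for the pigeonhole.
    l₀ = take k l
    |l₀|≡k : length l₀ ≡ k
    |l₀|≡k = trans (List.length-take k l) (m≤n⇒m⊓n≡m (≮⇒≥ l≮k))
    indep₀ : Independent (frequent d) l₀
    indep₀ = AllPairs-resp-⊆ (take-⊆ k l) indep
    Label : Fin M → Vec (Fin (length l₀)) 2 → Set
    Label y (i ∷ j ∷ []) = i Fin.< j × R y (List.lookup l₀ i) (List.lookup l₀ j) ≡ true
    label : ∀ y → ∃ (Label y)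
    label y with adjacent-positions (R y) l₀
    ... | inj₂ (i , j , p) = i ∷ j ∷ [] , p
    ... | inj₁ none = contradiction |l₀|≡k
      (<⇒≢ (α-R y (AllPairs.zip (AllPairs.map proj₁ indep₀ , none))))
    popular : ∃₂ λ bs ys → ys ⊆ allFin M × d < length ys × All (λ y → Label y bs) ys
    popular = pigeonhole-Vec (length l₀) 2 d (All.universal label (allFin M))
      (subst₂ (λ a b → a ^ 2 * d < b) (sym |l₀|≡k) (sym (length-allFin M)) lt)
    infrequent : ¬ (∃₂ λ bs ys → ys ⊆ allFin M × d < length ys × All (λ y → Label y bs) ys)
    -- Since `d < length ys`, there is a row to read `i < j` from, and independence then says that
    -- the pair is not frequent.
    infrequent (_ ∷ _ ∷ [] , _ ∷ _ , _ , _ , (i<j , _) ∷ _)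
      with proj₂ (AllPairs-lookup indep₀ i<j)
    infrequent (i ∷ j ∷ [] , ys@(_ ∷ _) , ys⊆ , d< , all) | eq =
      contradiction (trans (sym (dec-true (d <? _) (≤-trans d< (rows-largest ys⊆ (All.map proj₂ all))))) eq) λ ()

  Joined : ∀ {t} → Fin N → Fin N → Vec (Fin M) t → Vec (Fin M) t → Set
  Joined v u K Y = IsClique (C v) Y × IsClique (C u) K
    × (∀ i j → C u (lookup K i) (lookup Y j) ≡ true)
    × (∀ i → R (lookup Y i) v u ≡ true) × (∀ i → R (lookup K i) v u ≡ true)

  -- In column `u` the outer factor `k ^ t` of the threshold pays for `K`. The `k ^ t * 1` common
  -- neighbours that remain pay for `Y` in column `v`.
  frequent⇒joined : ∀ t {v u} → frequent (k ^ t * (k ^ t * 1)) v u ≡ true →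
    ∃₂ λ (K Y : Vec (Fin M) t) → Joined v u K Y
  frequent⇒joined t {v} {u} freq =
    let K , l₁ , K-clique , K∈ , l₁⊆ , le₁ , K-l₁ =
          clique-with-neighbours (α-C u) 1≤k (C-sym u) t (k ^ t * 1)
            (*-mono-≤ (m^n>0 k {{>-nonZero 1≤k}} t) ≤-refl) rows-unique (<⇒≤ large)
        Y , _ , Y-clique , Y∈ , _ =
          clique-with-neighbours (α-C v) 1≤k (C-sym v) t 1 ≤-refl (AllPairs-resp-⊆ l₁⊆ rows-unique) le₁
    in K , Y , Y-clique , K-clique , (λ i j → K-l₁ (Y∈ j) i)
       , (λ i → in-rows (Any-resp-⊆ l₁⊆ (Y∈ i))) , (λ i → in-rows (K∈ i))
    where
    d = k ^ t * (k ^ t * 1)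
    large : d < length (rows v u)
    large = does-true (d <? length (rows v u)) freq
    rows-unique : Unique (rows v u)
    rows-unique = Unique.filter⁺ (λ y → R y v u Bool.≟ true) (Unique.allFin⁺ M)
    in-rows : ∀ {y} → y ∈ rows v u → R y v u ≡ true
    in-rows y∈ = proj₂ (∈-filter⁻ (λ y → R y v u Bool.≟ true) {xs = allFin M} y∈)

  -- A vertex `v` of high degree in the frequency graph is fixed. Its neighbours `u` are then sorted
  -- by their `K` and next by their `Y`, with at most `M ^ t` choices each; the `suc` supplies the
  -- strict inequality for the pigeonhole.
  skeleton : ∀ t q → k ^ 2 * (k ^ t * (k ^ t * 1)) < M → k * suc (M ^ t * (M ^ t * q)) ≤ N →
    Skeleton R C t q
  skeleton t q M-large N-large =
    let v , l₀ , _ , l₀⊆ , |l₀| , freq =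
          high-degree (α-frequent _ M-large) (suc (M ^ t * (M ^ t * q))) (s≤s z≤n) (Unique.allFin⁺ N)
            (≤-trans N-large (≤-reflexive (sym (length-allFin N))))
        K , l₁ , l₁⊆ , |l₁| , joined₁ =
          pigeonhole-Vec M t (M ^ t * q) {λ u K → ∃ (Joined v u K)} (All.map (frequent⇒joined t) freq) |l₀|
        Y , U , U⊆ , |U| , joined = pigeonhole-Vec M t q {λ u → Joined v u K} joined₁ |l₁|
    in record
      { v = v ; Y = Y ; K = K ; U = U
      ; U-unique = AllPairs-resp-⊆ (⊆-trans U⊆ (⊆-trans l₁⊆ l₀⊆)) (Unique.allFin⁺ N)
      ; U-large  = |U|
      -- This property does not mention `u`, so any member of `U` provides it.
      ; Y-clique = proj₁ (proj₂ (first |U| joined))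
      ; K-clique = λ u∈ → proj₁ (proj₂ (All.lookup joined u∈))
      ; K-Y      = λ u∈ → proj₁ (proj₂ (proj₂ (All.lookup joined u∈)))
      ; Y-row    = λ u∈ → proj₁ (proj₂ (proj₂ (proj₂ (All.lookup joined u∈))))
      ; K-row    = λ u∈ → proj₂ (proj₂ (proj₂ (proj₂ (All.lookup joined u∈))))
      }
    where
    first : ∀ {P : Fin N → Set} {U} → q < length U → All (λ u → P u) U → ∃ P
    first _ (p ∷ _) = _ , p

-- Cycles

-- A cycle of length suc m, traversed periodically.
record Tour {c r} (H : GridSubgraph c r) (m : ℕ) (w : ℕ → Cell c r) : Set where
  field
    injective : ∀ {i j} → i ≤ m → j ≤ m → w i ≡ w j → i ≡ j
    period    : ∀ i → w (i + suc m) ≡ w i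
    covers    : ∀ {u} → V H u ≡ true → ∃ λ i → i ≤ m × w i ≡ u
    vertex    : ∀ i → V H (w i) ≡ true
    edge      : ∀ i → E H (w i) (w (suc i)) ≡ true
    edges     : ∀ {u u′} → E H u u′ ≡ true →
      ∃ λ i → i ≤ m × ((u ≡ w i × u′ ≡ w (suc i)) ⊎ (u ≡ w (suc i) × u′ ≡ w i))

-- The cyclic successor is iterated from position 0, which gives periodicity without arithmetic
-- modulo `suc m`.
cycle⇒tour : ∀ {c r} {H : GridSubgraph c r} {m} → IsCycle H (suc m) → ∃ (Tour H m)
cycle⇒tour {H = H} {m} (_ , v , v-inj , v-covers , v-vertex , v-edges , v-edge) = v ∘ index , record
  { injective = λ i≤m j≤m eq → trans (sym (toℕ-index i≤m)) (trans (cong toℕ (v-inj eq)) (toℕ-index j≤m))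
  ; period    = λ i → cong v (index-period i)
  ; covers    = λ {u} Vu → let i , eq = v-covers u Vu in
      toℕ i , Fin.toℕ≤pred[n] i , trans (cong v (index-toℕ i)) eq
  ; vertex    = v-vertex ∘ index
  ; edge      = λ i → v-edge _ _ (next-succ (index i))
  ; edges     = λ {u} {u′} e → let i , j , succ , p = v-edges u u′ e in
      toℕ i , Fin.toℕ≤pred[n] i
      , subst₂ (λ a b → (u ≡ v a × u′ ≡ v b) ⊎ (u ≡ v b × u′ ≡ v a))
          (sym (index-toℕ i)) (sym (trans (cong next (index-toℕ i)) (succ-unique (next-succ i) succ))) p
  }
  where
  next : Fin (suc m) → Fin (suc m)
  next i with suc (toℕ i) <? suc m
  ... | yes lt = Fin.fromℕ< lt
  ... | no  _  = zero
  next-succ : ∀ i → CycSucc (suc m) i (next i)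
  next-succ i with suc (toℕ i) <? suc m
  ... | yes lt = inj₁ (sym (Fin.toℕ-fromℕ< lt))
  ... | no ≮   = inj₂ (≤-antisym (Fin.toℕ<n i) (≮⇒≥ ≮) , refl)
  succ-unique : ∀ {i j j′} → CycSucc (suc m) i j → CycSucc (suc m) i j′ → j ≡ j′
  succ-unique (inj₁ p) (inj₁ q) = Fin.toℕ-injective (trans (sym p) q)
  succ-unique {j = j} (inj₁ p) (inj₂ (q , _)) = contradiction (trans (sym p) q) (<⇒≢ (Fin.toℕ<n j))
  succ-unique {j′ = j} (inj₂ (q , _)) (inj₁ p) = contradiction (trans (sym p) q) (<⇒≢ (Fin.toℕ<n j))
  succ-unique (inj₂ (_ , p)) (inj₂ (_ , q)) = Fin.toℕ-injective (trans p (sym q))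
  index : ℕ → Fin (suc m)
  index zero    = zero
  index (suc i) = next (index i)
  toℕ-index : ∀ {i} → i ≤ m → toℕ (index i) ≡ i
  toℕ-index {zero} _ = refl
  toℕ-index {suc i} i<m with next-succ (index i)
  ... | inj₁ p = trans (sym p) (cong suc (toℕ-index (<⇒≤ i<m)))
  ... | inj₂ (p , _) = contradiction (suc-injective (trans (cong suc (sym (toℕ-index (<⇒≤ i<m)))) p)) (<⇒≢ i<m)
  index-toℕ : ∀ i → index (toℕ i) ≡ i
  index-toℕ i = Fin.toℕ-injective (toℕ-index (Fin.toℕ≤pred[n] i))
  index-period : ∀ i → index (i + suc m) ≡ index i
  index-period zero = succ-unique (next-succ (index m)) (inj₂ (cong suc (toℕ-index ≤-refl) , refl))
  index-period (suc i) = cong next (index-period i)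

-- Rotation of tours and convexity of lines

module _ {c r} {H : GridSubgraph c r} {m : ℕ} where

  shift : ∀ {w} → Tour H m w → Tour H m (w ∘ suc)
  shift {w} T = record
    { injective = inj
    ; period    = λ i → period (suc i)
    ; covers    = λ Vu → cov (covers Vu)
    ; vertex    = vertex ∘ suc
    ; edge      = edge ∘ suc
    ; edges     = λ e → edg (edges e)
    }
    where
    open Tour T
    close : ∀ {j} → suc j ≤ m → w (suc m) ≢ w (suc j)
    close lt eq = case injective z≤n lt (trans (sym (period 0)) eq) of λ ()
    inj : ∀ {i j} → i ≤ m → j ≤ m → w (suc i) ≡ w (suc j) → i ≡ j
    inj i≤m j≤m eq with m≤n⇒m<n∨m≡n i≤m | m≤n⇒m<n∨m≡n j≤m
    ... | inj₁ i<m  | inj₁ j<m  = suc-injective (injective i<m j<m eq)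
    ... | inj₁ i<m  | inj₂ refl = contradiction (sym eq) (close i<m)
    ... | inj₂ refl | inj₁ j<m  = contradiction eq (close j<m)
    ... | inj₂ refl | inj₂ refl = refl
    cov : ∀ {u} → (∃ λ i → i ≤ m × w i ≡ u) → ∃ λ i → i ≤ m × w (suc i) ≡ u
    cov (zero  , _ , eq) = m , ≤-refl , trans (period 0) eq
    cov (suc i , i<m , eq) = i , <⇒≤ i<m , eq
    edg : ∀ {u u′} →
      (∃ λ i → i ≤ m × ((u ≡ w i × u′ ≡ w (suc i)) ⊎ (u ≡ w (suc i) × u′ ≡ w i))) →
      ∃ λ i → i ≤ m × ((u ≡ w (suc i) × u′ ≡ w (suc (suc i))) ⊎ (u ≡ w (suc (suc i)) × u′ ≡ w (suc i)))
    edg {u} {u′} (zero , _ , p) = m , ≤-refl ,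
      subst₂ (λ a b → (u ≡ a × u′ ≡ b) ⊎ (u ≡ b × u′ ≡ a)) (sym (period 0)) (sym (period 1)) p
    edg (suc i , i<m , p) = i , <⇒≤ i<m , p

  rotate : ∀ {w} b → Tour H m w → ∃ λ w′ → Tour H m w′ × (∀ i → w′ i ≡ w (b + i))
  rotate zero    T = _ , T , λ _ → refl
  rotate (suc b) T = rotate b (shift T)

  module _ {w} (T : Tour H m w) where
    open Tour T

    -- A path inside `P` that starts before position `l` moves by one position at a time. It cannot
    -- enter `l`, where `P` fails, nor wrap around between `w 0` and `w m`, so it stays before `l`.
    reach-blocked : ∀ {P : Cell c r → Set} → ¬ (P (w 0) × P (w m)) →
      ∀ {l j} → l < j → j ≤ m → ¬ P (w l) →
      ∀ {i u z} → i < l → u ≡ w i → z ≡ w j → P u → ¬ Reach H P u z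
    reach-blocked bar l<j j≤m ¬Pl i<l refl z≡ Pu here =
      <⇒≢ (<-trans i<l l<j) (injective (<⇒≤ (<-trans i<l (<-≤-trans l<j j≤m))) j≤m z≡)
    reach-blocked bar {l} l<j j≤m ¬Pl {i} i<l refl z≡ Pu (step {v = u′} e Pu′ path) with edges e
    ... | p , p≤m , inj₁ (eq , refl)
      with refl ← injective (<⇒≤ (<-≤-trans (<-trans i<l l<j) j≤m)) p≤m eq
      with m≤n⇒m<n∨m≡n i<l
    ...   | inj₁ si<l = reach-blocked bar l<j j≤m ¬Pl si<l refl z≡ Pu′ path
    ...   | inj₂ refl = ¬Pl Pu′
    reach-blocked {P} bar {l} l<j j≤m ¬Pl {i} i<l refl z≡ Pu (step e Pu′ path)
        | p , p≤m , inj₂ (eq , refl) with m≤n⇒m<n∨m≡n p≤m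
    -- This is the closing edge, from `w (suc m)`, which is `w 0`, back to `w m`.
    ...   | inj₂ refl = bar (subst P (trans eq (period 0)) Pu , Pu′)
    ...   | inj₁ p<m with refl ← injective (<⇒≤ (<-≤-trans (<-trans i<l l<j) j≤m)) p<m eq =
      reach-blocked bar l<j j≤m ¬Pl (<-trans (n<1+n p) i<l) refl z≡ Pu′ path

    -- A connected part of the cycle is an arc, hence an interval of positions unless it contains
    -- both ends of the closing edge. The double negation is there because `P` need not be
    -- decidable; for rows and columns it is removed below.
    convex : ∀ {P : Cell c r → Set} → InducedConnected H P → ¬ (P (w 0) × P (w m)) →
      ∀ {i l j} → i ≤ l → l ≤ j → j ≤ m → P (w i) → P (w j) → ¬ ¬ P (w l)
    convex conn bar i≤l l≤j j≤m Pi Pj ¬Pl with m≤n⇒m<n∨m≡n i≤l | m≤n⇒m<n∨m≡n l≤j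
    ... | inj₂ refl | _         = ¬Pl Pi
    ... | inj₁ _    | inj₂ refl = ¬Pl Pj
    ... | inj₁ i<l  | inj₁ l<j  = reach-blocked bar l<j j≤m ¬Pl i<l refl refl Pi (conn _ _ Pi Pj)

    row-convex : Simple H → ∀ {y} → ¬ (row (w 0) ≡ y × row (w m) ≡ y) →
      ∀ {i l j} → i ≤ l → l ≤ j → j ≤ m → row (w i) ≡ y → row (w j) ≡ y → row (w l) ≡ y
    row-convex (simple , _) {y} bar {l = l} i≤l l≤j j≤m pi pj with row (w l) Fin.≟ y
    ... | yes p = p
    ... | no ¬p = ⊥-elim (convex {InRow H y} (simple y) (λ { ((_ , p) , (_ , q)) → bar (p , q) })
                    i≤l l≤j j≤m (vertex _ , pi) (vertex _ , pj) (¬p ∘ proj₂))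

    col-convex : Simple H → ∀ {x} → ¬ (col (w 0) ≡ x × col (w m) ≡ x) →
      ∀ {i l j} → i ≤ l → l ≤ j → j ≤ m → col (w i) ≡ x → col (w j) ≡ x → col (w l) ≡ x
    col-convex (_ , simple) {x} bar {l = l} i≤l l≤j j≤m pi pj with col (w l) Fin.≟ x
    ... | yes p = p
    ... | no ¬p = ⊥-elim (convex {InCol H x} (simple x) (λ { ((_ , p) , (_ , q)) → bar (p , q) })
                    i≤l l≤j j≤m (vertex _ , pi) (vertex _ , pj) (¬p ∘ proj₂))

-- Transposition

transpose : ∀ {c r} → GridSubgraph c r → GridSubgraph r c
transpose H = record
  { V      = V H ∘ swap
  ; E      = λ u v → E H (swap u) (swap v)
  ; E-V    = λ u v → E-V H (swap u) (swap v)
  ; E-sym  = λ u v → E-sym H (swap u) (swap v)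
  ; E-irr  = E-irr H ∘ swap
  ; E-grid = λ u v → Sum.swap ∘ E-grid H (swap u) (swap v)
  }

transpose-reach : ∀ {c r} {H : GridSubgraph c r} {P : Cell c r → Set} {u v} →
  Reach H P u v → Reach (transpose H) (P ∘ swap) (swap u) (swap v)
transpose-reach here = here
transpose-reach (step e p path) = step e p (transpose-reach path)

transpose-simpleCycle : ∀ {c r} {H : GridSubgraph c r} {n} → IsSimpleCycle H n → IsSimpleCycle (transpose H) n
transpose-simpleCycle ((3≤n , v , v-inj , covers , vertex , edges , edge) , rows , cols) =
  ( 3≤n , swap ∘ v , v-inj ∘ cong swap
  , (λ u Vu → map₂ (cong swap) (covers (swap u) Vu)) , vertex
  , (λ u u′ e → map₂ (map₂ (map₂ (Sum.map both both))) (edges (swap u) (swap u′) e)) , edge)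
  , (λ x u v p q → transpose-reach (cols x (swap u) (swap v) p q))
  , (λ y u v p q → transpose-reach (rows y (swap u) (swap v) p q))
  where
  both : ∀ {A B : Set} {a c : A × B} {b d : B × A} → swap a ≡ b × swap c ≡ d → a ≡ swap b × c ≡ swap d
  both (refl , refl) = refl , refl

transpose-coclique : ∀ {c r} {G : GridSubgraph c r} {k} → HasCoclique (transpose G) k → HasCoclique G k
transpose-coclique (inj₁ p) = inj₂ p
transpose-coclique (inj₂ p) = inj₁ p

transpose-contains : ∀ {c r c′ r′} {G : GridSubgraph c r} {H : GridSubgraph c′ r′} →
  Contains (transpose G) (transpose H) → Contains G H
transpose-contains e = record
  { φc = φr ; φr = φc ; φc-inj = φr-inj ; φr-inj = φc-inj
  ; edges = λ x y x′ y′ → edges y x y′ x′ }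
  where open Embedding e

transpose-inPGR : ∀ {c r} {H : GridSubgraph c r} → InPGR (transpose H) → InPGR H
transpose-inPGR (C , bound) = C , λ k 2≤k → let N , N≤ , ramsey = bound k 2≤k in
  N , N≤ , λ G spanning →
    Sum.map transpose-contains (transpose-coclique {G = G}) (ramsey (transpose G) (spanning ∘ swap))

-- Good columns and rows

-- The columns that can play the role of x₀.
GoodCol BadCol : ∀ {c r} → GridSubgraph c r → Fin c → Set
GoodCol H x₀ = ∀ {x y y′} → x ≢ x₀ → E H (x , y) (x , y′) ≡ true →
  V H (x₀ , y) ≡ true → V H (x₀ , y′) ≡ true → ⊥
BadCol H x₀ = ∃ λ x → ∃₂ λ y y′ → x ≢ x₀ × E H (x , y) (x , y′) ≡ true
  × V H (x₀ , y) ≡ true × V H (x₀ , y′) ≡ true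

good-or-bad : ∀ {c r} (H : GridSubgraph c r) x₀ → GoodCol H x₀ ⊎ BadCol H x₀
good-or-bad H x₀ with Fin.any? (λ x → Fin.any? λ y → Fin.any? λ y′ →
    ¬? (x Fin.≟ x₀) ×-dec (E H (x , y) (x , y′) Bool.≟ true)
    ×-dec (V H (x₀ , y) Bool.≟ true) ×-dec (V H (x₀ , y′) Bool.≟ true))
... | yes bad = inj₂ bad
... | no ¬bad = inj₁ λ x≢ e p q → ¬bad (_ , _ , _ , x≢ , e , p , q)

edge-distinct : ∀ {c r} (H : GridSubgraph c r) {u v} → E H u v ≡ true → u ≢ v
edge-distinct H = adjacent-distinct {g = E H} (E-irr H)

-- The closing edge is vertical, in column `x`. By convexity the tour runs in row `y` from 0 to `a`,
-- in column `x₀` from `a` to `b`, and in row `y′` from `b` to `m`. Badness of `x`, `y` and `y′`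
-- forces the other three sides to be single edges.
module Rectangle {c r} {H : GridSubgraph c r} {m w} (T : Tour H m w) (simple : Simple H)
  {x x₀ y y′} (x≢x₀ : x ≢ x₀) (w0 : w 0 ≡ (x , y)) (wm : w m ≡ (x , y′))
  (V₀ : V H (x₀ , y) ≡ true) (V₀′ : V H (x₀ , y′) ≡ true) where
  open Tour T

  y≢y′ : y ≢ y′
  y≢y′ refl = edge-distinct H (edge m) (trans wm (sym (trans (period 0) w0)))

  a b : ℕ
  a = proj₁ (covers V₀)
  b = proj₁ (covers V₀′)
  a≤m : a ≤ m
  a≤m = proj₁ (proj₂ (covers V₀))
  b≤m : b ≤ m
  b≤m = proj₁ (proj₂ (covers V₀′))
  wa : w a ≡ (x₀ , y)
  wa = proj₂ (proj₂ (covers V₀))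
  wb : w b ≡ (x₀ , y′)
  wb = proj₂ (proj₂ (covers V₀′))

  row-y : ∀ {l} → l ≤ a → row (w l) ≡ y
  row-y l≤a = row-convex T simple (λ { (_ , q) → y≢y′ (trans (sym q) (cong row wm)) })
    z≤n l≤a a≤m (cong row w0) (cong row wa)

  row-y′ : ∀ {l} → b ≤ l → l ≤ m → row (w l) ≡ y′
  row-y′ b≤l l≤m = row-convex T simple (λ { (p , _) → y≢y′ (trans (cong row (sym w0)) p) })
    b≤l l≤m ≤-refl (cong row wb) (cong row wm)

  row-y⇒<b : ∀ {l} → l ≤ m → row (w l) ≡ y → l < b
  row-y⇒<b l≤m p = ≰⇒> λ b≤l → y≢y′ (trans (sym p) (row-y′ b≤l l≤m))

  row-y′⇒>a : ∀ {l} → row (w l) ≡ y′ → a < l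
  row-y′⇒>a p = ≰⇒> λ l≤a → y≢y′ (trans (sym (row-y l≤a)) p)

  col-x₀ : ∀ {l} → a ≤ l → l ≤ b → col (w l) ≡ x₀
  col-x₀ a≤l l≤b = col-convex T simple (λ { (p , _) → x≢x₀ (trans (cong col (sym w0)) p) })
    a≤l l≤b b≤m (cong col wa) (cong col wb)

  -- A position between `a` and `b` is in column `x₀`, not `x`; all others are on the two horizontal
  -- sides.
  col-x-rows : ∀ {z} → V H (x , z) ≡ true → z ≡ y ⊎ z ≡ y′
  col-x-rows Vz with covers Vz
  ... | l , l≤m , eq with l ≤? a | b ≤? l
  ...   | yes l≤a | _       = inj₁ (trans (cong row (sym eq)) (row-y l≤a))
  ...   | no _    | yes b≤l = inj₂ (trans (cong row (sym eq)) (row-y′ b≤l l≤m))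
  ...   | no l≰a  | no b≰l  = contradiction
    (trans (cong col (sym eq)) (col-x₀ (≰⇒≥ l≰a) (≰⇒≥ b≰l))) x≢x₀

  edge-index : ∀ {u u′} → E H u u′ ≡ true → u ≢ w 0 → u′ ≢ w 0 →
    ∃ λ p → p < m × ((u ≡ w p × u′ ≡ w (suc p)) ⊎ (u ≡ w (suc p) × u′ ≡ w p))
  edge-index e u≢ u′≢ with edges e
  ... | p , p≤m , ends with m≤n⇒m<n∨m≡n p≤m | ends
  ...   | inj₁ p<m  | _             = p , p<m , ends
  ...   | inj₂ refl | inj₁ (_ , eq) = contradiction (trans eq (period 0)) u′≢
  ...   | inj₂ refl | inj₂ (eq , _) = contradiction (trans eq (period 0)) u≢

  -- An end in row `y` comes before `b` and an end in row `y′` after `a`. As the ends are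
  -- consecutive, this puts them on the side in column `x₀`, so they are its corners `w a` and
  -- `w b`.
  vertical : ∀ {x₁} → x₁ ≢ x → E H (x₁ , y) (x₁ , y′) ≡ true → b ≡ suc a
  vertical {x₁} x₁≢x e with edge-index e (λ eq → x₁≢x (cong col (trans eq w0))) (λ eq → x₁≢x (cong col (trans eq w0)))
  ... | p , p<m , inj₁ (eq , eq′) =
    trans (sym (injective p<m b≤m (trans (sym eq′) (trans (cong (_, y′) x₁≡x₀) (sym wb)))))
          (cong suc (injective (<⇒≤ p<m) a≤m (trans (sym eq) (trans (cong (_, y) x₁≡x₀) (sym wa)))))
    where
    x₁≡x₀ : x₁ ≡ x₀
    x₁≡x₀ = trans (cong col eq) (col-x₀ (≤-pred (row-y′⇒>a (cong row (sym eq′))))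
              (<⇒≤ (row-y⇒<b (<⇒≤ p<m) (cong row (sym eq)))))
  ... | p , p<m , inj₂ (eq , eq′) = contradiction (row-y′⇒>a {p} (cong row (sym eq′))) (<⇒≯ (≤-reflexive sp≡a))
    where
    x₁≡x₀ : x₁ ≡ x₀
    x₁≡x₀ = trans (cong col eq) (col-x₀ (<⇒≤ (<-trans (row-y′⇒>a (cong row (sym eq′))) (n<1+n p)))
              (<⇒≤ (row-y⇒<b p<m (cong row (sym eq)))))
    sp≡a : suc p ≡ a
    sp≡a = injective p<m a≤m (trans (sym eq) (trans (cong (_, y) x₁≡x₀) (sym wa)))

  bad-x : BadCol H x → b ≡ suc a
  bad-x (x₁ , z , z′ , x₁≢x , e , Vz , Vz′) with col-x-rows Vz | col-x-rows Vz′
  ... | inj₁ refl | inj₁ refl = contradiction refl (edge-distinct H e)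
  ... | inj₁ refl | inj₂ refl = vertical x₁≢x e
  ... | inj₂ refl | inj₁ refl = vertical x₁≢x (E-sym H _ _ e)
  ... | inj₂ refl | inj₂ refl = contradiction refl (edge-distinct H e)

  module _ (b≡sa : b ≡ suc a) where

    two-rows : ∀ {u} → V H u ≡ true → row u ≡ y ⊎ row u ≡ y′
    two-rows Vu with covers Vu
    ... | l , l≤m , refl with l ≤? a
    ...   | yes l≤a = inj₁ (row-y l≤a)
    ...   | no l≰a  = inj₂ (row-y′ (≤-trans (≤-reflexive b≡sa) (≰⇒> l≰a)) l≤m)

    -- A column other than `x` occupies an interval of positions. If it meets both rows, the
    -- interval has a position at most `a` and one beyond `a`, so it contains the corner `w a`.
    common-column : ∀ {d} → V H (d , y) ≡ true → V H (d , y′) ≡ true → d ≡ x ⊎ d ≡ x₀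
    common-column {d} Vd Vd′ with d Fin.≟ x | covers Vd | covers Vd′
    ... | yes d≡x | _ | _ = inj₁ d≡x
    ... | no d≢x | i , i≤m , eq | j , j≤m , eq′ = inj₂ (trans
      (sym (col-convex T simple (λ { (p , _) → d≢x (trans (sym p) (cong col w0)) })
        (≤-pred (≤-trans (row-y⇒<b i≤m (cong row eq)) (≤-reflexive b≡sa)))
        (<⇒≤ (row-y′⇒>a (cong row eq′))) j≤m (cong col eq) (cong col eq′)))
      (cong col wa))

    orient : ∀ {z d d′} → d ≡ x ⊎ d ≡ x₀ → d′ ≡ x ⊎ d′ ≡ x₀ → E H (d , z) (d′ , z) ≡ true →
      E H (x , z) (x₀ , z) ≡ true
    orient (inj₁ refl) (inj₁ refl) e = contradiction refl (edge-distinct H e)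
    orient (inj₁ refl) (inj₂ refl) e = e
    orient (inj₂ refl) (inj₁ refl) e = E-sym H _ _ e
    orient (inj₂ refl) (inj₂ refl) e = contradiction refl (edge-distinct H e)

    -- The edge that makes row `y` bad must lie in row `y′` and join two columns common to both
    -- rows, so it joins the corners `w m` and `w b`. For `bad-y′` it joins `w 0` and `w a` in the
    -- same way.
    bad-y : BadCol (transpose H) y → m ≡ suc b
    bad-y (z , d , d′ , z≢y , e , Vd , Vd′) with two-rows (proj₁ (E-V H _ _ e))
    ... | inj₁ refl = contradiction refl z≢y
    ... | inj₂ refl
      with edge-index (orient (common-column Vd (proj₁ (E-V H _ _ e))) (common-column Vd′ (proj₂ (E-V H _ _ e))) e)
             (λ eq → y≢y′ (cong row (sym (trans eq w0)))) (λ eq → y≢y′ (cong row (sym (trans eq w0))))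
    ...   | p , p<m , inj₁ (eq , _) = contradiction (injective (<⇒≤ p<m) ≤-refl (trans (sym eq) (sym wm))) (<⇒≢ p<m)
    ...   | p , p<m , inj₂ (eq , eq′) = trans (sym (injective p<m ≤-refl (trans (sym eq) (sym wm))))
      (cong suc (injective (<⇒≤ p<m) b≤m (trans (sym eq′) (sym wb))))

    bad-y′ : BadCol (transpose H) y′ → a ≡ 1
    bad-y′ (z , d , d′ , z≢y′ , e , Vd , Vd′) with two-rows (proj₁ (E-V H _ _ e))
    ... | inj₂ refl = contradiction refl z≢y′
    ... | inj₁ refl
      with edges (orient (common-column (proj₁ (E-V H _ _ e)) Vd) (common-column (proj₂ (E-V H _ _ e)) Vd′) e)
    ...   | p , p≤m , inj₁ (eq , eq′) with refl ← injective p≤m z≤n (trans (sym eq) (sym w0)) =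
      injective a≤m 1≤m (trans wa eq′)
      where
      1≤m : 1 ≤ m
      1≤m = ≤-trans (s≤s z≤n) (≤-trans (≤-reflexive (sym b≡sa)) b≤m)
    ...   | p , p≤m , inj₂ (eq , eq′) with refl ← injective p≤m a≤m (trans (sym eq′) (sym wa)) =
      case injective (≤-trans (≤-reflexive (sym b≡sa)) b≤m) z≤n (trans (sym eq) (sym w0)) of λ ()

  all-bad : BadCol H x → BadCol (transpose H) y → BadCol (transpose H) y′ → m ≡ 3
  all-bad bx by by′ with bad-x bx
  ... | b≡sa = trans (bad-y b≡sa by) (cong suc (trans b≡sa (cong suc (bad-y′ b≡sa by′))))

-- If the column of `w 0` is bad, its witness is a vertical edge in another column `x`. If `x` and
-- both rows of that edge are bad as well, `Rectangle` yields a 4-cycle. A vertex on the good line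
-- is returned so that the tour can be rotated to start there.
good-column-or-row : ∀ {c r} {H : GridSubgraph c r} {m w} → Tour H m w → Simple H → m ≢ 3 →
  (∃ λ u → V H u ≡ true × GoodCol H (col u)) ⊎ (∃ λ u → V H u ≡ true × GoodCol (transpose H) (row u))
good-column-or-row {c} {r} {H} {m} {w} T simple m≢3 with good-or-bad H (col (w 0))
... | inj₁ good = inj₁ (w 0 , Tour.vertex T 0 , good)
... | inj₂ (x , y , y′ , x≢ , e , V₀ , V₀′)
  with good-or-bad H x | good-or-bad (transpose H) y | good-or-bad (transpose H) y′
...   | inj₁ good | _ | _ = inj₁ (_ , proj₁ (E-V H _ _ e) , good)
...   | inj₂ _ | inj₁ good | _ = inj₂ (_ , proj₁ (E-V H _ _ e) , good)
...   | inj₂ _ | inj₂ _ | inj₁ good = inj₂ (_ , proj₂ (E-V H _ _ e) , good)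
...   | inj₂ bx | inj₂ by | inj₂ by′ = ⊥-elim (m≢3 (m≡3 (Tour.edges T e)))
  where
  -- Start the tour just after the edge e.
  start : ∀ {i u u′} → w i ≡ u → w (suc i) ≡ u′ → ∃ λ w′ → Tour H m w′ × w′ 0 ≡ u′ × w′ m ≡ u
  start {i} refl refl = let w′ , T′ , eq = rotate (suc i) T in
    w′ , T′ , trans (eq 0) (cong (w ∘ suc) (+-identityʳ i))
    , trans (eq m) (trans (cong w (sym (+-suc i m))) (Tour.period T i))
  m≡3 : (∃ λ i → i ≤ m × (((x , y) ≡ w i × (x , y′) ≡ w (suc i)) ⊎ ((x , y) ≡ w (suc i) × (x , y′) ≡ w i))) → m ≡ 3
  m≡3 (i , _ , inj₁ (p , q)) = let w′ , T′ , w0 , wm = start (sym p) (sym q) in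
    Rectangle.all-bad T′ simple x≢ w0 wm V₀′ V₀ bx by′ by
  m≡3 (i , _ , inj₂ (q , p)) = let w′ , T′ , w0 , wm = start (sym p) (sym q) in
    Rectangle.all-bad T′ simple x≢ w0 wm V₀ V₀′ bx by by′

-- Growing an embedding along a tour

module Grow {c r m N M k} {H : GridSubgraph c r} {w} (T : Tour H m w) (simple : Simple H)
  (x₀ : Fin c) (w0 : col (w 0) ≡ x₀) (1≤k : 1 ≤ k)
  (R : Fin M → Graph (Fin N)) (α-R : ∀ y → IndependenceBelow k (R y))
  (ψ : Fin r → Fin M) (φ₀ : Fin c → Fin N) (φ₀-inj : Injective _≡_ _≡_ φ₀) where

  -- Only horizontal edges avoiding `x₀` are recorded, as the skeleton provides those at `x₀`. By
  -- `range`, columns that have no place in `U` keep their value under `φ₀`, so `φ` is total and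
  -- injective at every stage.
  record Grown (i : ℕ) (U : List (Fin N)) : Set where
    field
      φ         : Fin c → Fin N
      injective : Injective _≡_ _≡_ φ
      fixed     : φ x₀ ≡ φ₀ x₀
      range     : ∀ x → φ x ≡ φ₀ x ⊎ φ x ∈ U
      placed    : ∀ {j} → j ≤ i → col (w j) ≢ x₀ → φ (col (w j)) ∈ U
      edges     : ∀ {j} → j < i → col (w j) ≢ x₀ → col (w (suc j)) ≢ x₀ → col (w j) ≢ col (w (suc j)) →
                  R (ψ (row (w j))) (φ (col (w j))) (φ (col (w (suc j)))) ≡ true

  -- Had the column been visited before, convexity would put `w i` in it. Convexity applies since
  -- `w 0` lies in column `x₀`.
  fresh : ∀ {i j} → suc i ≤ m → j ≤ i → col (w (suc i)) ≢ x₀ → col (w i) ≢ col (w (suc i)) →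
    col (w j) ≢ col (w (suc i))
  fresh {i} i<m j≤i new turn eq = turn
    (col-convex T simple (λ { (p , _) → new (trans (sym p) w0) }) j≤i (n≤1+n i) i<m eq refl)

  stay : ∀ {i U} → col (w (suc i)) ≡ x₀ ⊎ col (w (suc i)) ≡ col (w i) → Grown i U → Grown (suc i) U
  stay {i} {U} old g = record
    { φ = φ ; injective = injective ; fixed = fixed ; range = range
    ; placed = placed′ ; edges = edges′ }
    where
    open Grown g
    placed′ : ∀ {j} → j ≤ suc i → col (w j) ≢ x₀ → φ (col (w j)) ∈ U
    placed′ j≤ new with m≤n⇒m<n∨m≡n j≤
    ... | inj₁ (s≤s j≤i) = placed j≤i new
    ... | inj₂ refl      = [ (λ eq → contradiction eq new)
      , (λ eq → subst (λ x → φ x ∈ U) (sym eq) (placed ≤-refl (new ∘ trans eq))) ]′ old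
    edges′ : ∀ {j} → j < suc i → col (w j) ≢ x₀ → col (w (suc j)) ≢ x₀ → col (w j) ≢ col (w (suc j)) →
      R (ψ (row (w j))) (φ (col (w j))) (φ (col (w (suc j)))) ≡ true
    edges′ (s≤s j≤i) p q turn with m≤n⇒m<n∨m≡n j≤i
    ... | inj₁ j<i  = edges j<i p q turn
    ... | inj₂ refl = ⊥-elim ([ q , turn ∘ sym ]′ old)

  extend : ∀ {i U A b} → suc i ≤ m → (∀ x → φ₀ x ∉ U) → A ⊆ U → b ∈ U → b ∉ A →
    col (w (suc i)) ≢ x₀ → col (w i) ≢ col (w (suc i)) → (g : Grown i A) →
    (col (w i) ≢ x₀ → R (ψ (row (w i))) (Grown.φ g (col (w i))) b ≡ true) → Grown (suc i) U
  extend {i} {U} {A} {b} i<m φ₀∉ A⊆ b∈ b∉ new turn g joined = record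
    { φ = φ′ ; injective = injective′ ; fixed = trans (φ′-old (new ∘ sym)) fixed
    ; range = range′ ; placed = placed′ ; edges = edges′ }
    where
    open Grown g
    x′ = col (w (suc i))
    φ′ : Fin c → Fin N
    φ′ x = if does (x Fin.≟ x′) then b else φ x
    φ′-new : φ′ x′ ≡ b
    φ′-new with x′ Fin.≟ x′
    ... | yes _ = refl
    ... | no ≢  = contradiction refl ≢
    φ′-old : ∀ {x} → x ≢ x′ → φ′ x ≡ φ x
    φ′-old {x} x≢ with x Fin.≟ x′
    ... | yes eq = contradiction eq x≢
    ... | no _   = refl
    b≢φ : ∀ x → b ≢ φ x
    b≢φ x eq with range x
    ... | inj₁ p = φ₀∉ x (subst (_∈ U) (trans eq p) b∈)
    ... | inj₂ p = b∉ (subst (_∈ A) (sym eq) p)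
    injective′ : Injective _≡_ _≡_ φ′
    injective′ {p} {q} eq with p Fin.≟ x′ | q Fin.≟ x′
    ... | yes refl | yes refl = refl
    ... | yes _    | no _     = contradiction eq (b≢φ q)
    ... | no _     | yes _    = contradiction (sym eq) (b≢φ p)
    ... | no _     | no _     = injective eq
    range′ : ∀ x → φ′ x ≡ φ₀ x ⊎ φ′ x ∈ U
    range′ x with x Fin.≟ x′
    ... | yes _ = inj₂ b∈
    ... | no _  = Sum.map₂ (Any-resp-⊆ A⊆) (range x)
    placed′ : ∀ {j} → j ≤ suc i → col (w j) ≢ x₀ → φ′ (col (w j)) ∈ U
    placed′ j≤ p with m≤n⇒m<n∨m≡n j≤
    ... | inj₂ refl = subst (_∈ U) (sym φ′-new) b∈
    ... | inj₁ (s≤s j≤i) = subst (_∈ U) (sym (φ′-old (fresh i<m j≤i new turn)))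
                             (Any-resp-⊆ A⊆ (placed j≤i p))
    edges′ : ∀ {j} → j < suc i → col (w j) ≢ x₀ → col (w (suc j)) ≢ x₀ → col (w j) ≢ col (w (suc j)) →
      R (ψ (row (w j))) (φ′ (col (w j))) (φ′ (col (w (suc j)))) ≡ true
    edges′ {j} (s≤s j≤i) p q t with m≤n⇒m<n∨m≡n j≤i
    ... | inj₁ j<i  = trans (cong₂ (R (ψ (row (w j)))) (φ′-old (fresh i<m j≤i new turn)) (φ′-old (fresh i<m j<i new turn)))
                        (edges j<i p q t)
    ... | inj₂ refl = trans (cong₂ (R (ψ (row (w j)))) (φ′-old turn) φ′-new) (joined p)

  -- Every column of A, the complement of a maximal independent set of U, has
  -- a neighbour in U outside A.
  turn-step : ∀ {i} U → suc i ≤ m → Unique U → suc i * k ≤ length U → (∀ x → φ₀ x ∉ U) →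
    col (w (suc i)) ≢ x₀ → col (w i) ≢ col (w (suc i)) →
    (∀ {A} → A ⊆ U → i * k ≤ length A → Grown i A) → Grown (suc i) U
  turn-step {i} U i<m unique le φ₀∉ new turn rec with col (w i) Fin.≟ x₀
  turn-step {i} [] i<m unique le φ₀∉ new turn rec | yes old =
    contradiction (≤-trans (≤-trans 1≤k (m≤m+n k _)) le) λ ()
  -- After a vertex in column `x₀` no edge inside `U` is required, so the head of the list serves;
  -- losing it is within the allowance `k`.
  turn-step {i} (b ∷ A) i<m unique le φ₀∉ new turn rec | yes old =
    extend i<m φ₀∉ (b ∷ʳ ⊆-refl) (here refl) (Unique[x∷xs]⇒x∉xs unique) new turn
      (rec (b ∷ʳ ⊆-refl) (≤-pred (≤-trans (+-monoˡ-≤ (i * k) 1≤k) le))) (contradiction old)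
  turn-step {i} U i<m unique le φ₀∉ new turn rec | no p =
    let b , b∈I , joined = dominated (Grown.placed grown ≤-refl p) in
    extend i<m φ₀∉ A⊆ (Any-resp-⊆ I⊆ b∈I) (disjoint b∈I) new turn grown (λ _ → joined)
    where
    open MaximalIndependent (maximalIndependent (R (ψ (row (w i)))) unique)
    open ≤-Reasoning
    -- The earlier part of the tour is placed inside `A` first, so that the image of its last column
    -- has a neighbour in `I`, which is fresh. The loss is `length I < k`.
    grown : Grown i A
    grown = rec A⊆ (+-cancelˡ-≤ k _ _ (begin
      k + i * k           ≤⟨ le ⟩
      length U            ≡⟨ lengths ⟨
      length I + length A ≤⟨ +-monoˡ-≤ _ (<⇒≤ (α-R _ independent)) ⟩
      k + length A        ∎))

  -- The list shrinks as the recursion goes back along the tour, by at most `k` entries per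
  -- position; hence `i * k`. Position 0 is in column `x₀` and needs no place in `U`.
  grow : ∀ i {U} → i ≤ m → Unique U → i * k ≤ length U → (∀ x → φ₀ x ∉ U) → Grown i U
  grow zero _ _ _ _ = record
    { φ = φ₀ ; injective = φ₀-inj ; fixed = refl ; range = λ _ → inj₁ refl
    ; placed = λ { z≤n p → contradiction w0 p } ; edges = λ () }
  grow (suc i) {U} i<m unique le φ₀∉ with col (w (suc i)) Fin.≟ x₀ | col (w (suc i)) Fin.≟ col (w i)
  ... | yes old | _ = stay (inj₁ old) (grow i (<⇒≤ i<m) unique (≤-trans (m≤n+m _ k) le) φ₀∉)
  ... | no _ | yes old = stay (inj₂ old) (grow i (<⇒≤ i<m) unique (≤-trans (m≤n+m _ k) le) φ₀∉)
  ... | no new | no turn = turn-step U i<m unique le φ₀∉ new (turn ∘ sym)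
    λ A⊆ le′ → grow i (<⇒≤ i<m) (AllPairs-resp-⊆ A⊆ unique) le′ (λ x → φ₀∉ x ∘ Any-resp-⊆ A⊆)

-- Assembling the embedding from a skeleton

record Reserved (c q : ℕ) (l : List X) : Set where
  field
    reserve     : Vec X c
    rest        : List X
    reserve-inj : Injective _≡_ _≡_ (lookup reserve)
    reserve∈    : ∀ i → lookup reserve i ∈ l
    rest⊆       : rest ⊆ l
    rest-large  : q ≤ length rest
    reserve∉    : ∀ i → lookup reserve i ∉ rest

-- The reserved columns are provisional images under `φ₀`, and the final ones for columns of the
-- cycle that contain no vertex.
reserved : ∀ c {q} {l : List X} → Unique l → c + q ≤ length l → Reserved c q l
reserved zero {l = l} unique le = record
  { reserve = [] ; rest = l ; reserve-inj = λ { {()} } ; reserve∈ = λ () ; rest⊆ = ⊆-refl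
  ; rest-large = le ; reserve∉ = λ () }
reserved {X} (suc c) {l = x ∷ l} unique@(_ ∷ unique-l) (s≤s le) = record
  { reserve = x ∷ reserve ; rest = rest ; reserve-inj = inj
  ; reserve∈ = λ { zero → here refl ; (suc i) → there (reserve∈ i) } ; rest⊆ = x ∷ʳ rest⊆
  ; rest-large = rest-large
  ; reserve∉ = λ { zero → x∉l ∘ Any-resp-⊆ rest⊆ ; (suc i) → reserve∉ i } }
  where
  open Reserved (reserved c unique-l le)
  x∉l : x ∉ l
  x∉l = Unique[x∷xs]⇒x∉xs unique
  inj : Injective _≡_ _≡_ (lookup (x ∷ reserve))
  inj {zero}  {zero}  _  = refl
  inj {zero}  {suc j} eq = contradiction (subst (_∈ l) (sym eq) (reserve∈ j)) x∉l
  inj {suc i} {zero}  eq = contradiction (subst (_∈ l) eq (reserve∈ i)) x∉l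
  inj {suc i} {suc j} eq = cong suc (reserve-inj eq)

-- In `c + m * k`, the first term pays for the reserve and the second for growing along the `m`
-- steps of the tour.
module Embed {c r m N M k} {H : GridSubgraph c r} {w} (T : Tour H m w) (simple : Simple H)
  (good : GoodCol H (col (w 0))) (1≤k : 1 ≤ k) (G : GridSubgraph N N)
  (ι : Fin M → Fin N) (ι-inj : Injective _≡_ _≡_ ι)
  (α-R : ∀ y → IndependenceBelow k (λ x x′ → E G (x , ι y) (x′ , ι y)))
  (S : Skeleton (λ y x x′ → E G (x , ι y) (x′ , ι y)) (λ x y y′ → E G (x , ι y) (x , ι y′)) r (c + m * k))
  where
  open Skeleton S

  x₀ : Fin c
  x₀ = col (w 0)

  v∉U : v ∉ U
  v∉U v∈ = edge-distinct G (Y-row v∈ (row (w 0))) refl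

  open Reserved (reserved c U-unique (<⇒≤ U-large))

  φ₀ : Fin c → Fin N
  φ₀ x = if does (x Fin.≟ x₀) then v else lookup reserve x

  φ₀-inj : Injective _≡_ _≡_ φ₀
  φ₀-inj {p} {q} eq with p Fin.≟ x₀ | q Fin.≟ x₀
  ... | yes p≡ | yes q≡ = trans p≡ (sym q≡)
  ... | yes _  | no _   = contradiction (subst (_∈ U) (sym eq) (reserve∈ q)) v∉U
  ... | no _   | yes _  = contradiction (subst (_∈ U) eq (reserve∈ p)) v∉U
  ... | no _   | no _   = reserve-inj eq

  φ₀∉rest : ∀ x → φ₀ x ∉ rest
  φ₀∉rest x with x Fin.≟ x₀
  ... | yes _ = v∉U ∘ Any-resp-⊆ rest⊆
  ... | no _  = reserve∉ x

  φ₀-x₀ : φ₀ x₀ ≡ v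
  φ₀-x₀ with x₀ Fin.≟ x₀
  ... | yes _ = refl
  ... | no ≢  = contradiction refl ≢

  ψ : Fin r → Fin M
  ψ y = if V H (x₀ , y) then lookup Y y else lookup K y

  open Grow T simple x₀ refl 1≤k (λ y x x′ → E G (x , ι y) (x′ , ι y)) α-R ψ φ₀ φ₀-inj
  open Grown (grow m ≤-refl (AllPairs-resp-⊆ rest⊆ U-unique) rest-large φ₀∉rest)

  φ-x₀ : φ x₀ ≡ v
  φ-x₀ = trans fixed φ₀-x₀

  in-U : ∀ {x y} → V H (x , y) ≡ true → x ≢ x₀ → φ x ∈ U
  in-U Vx x≢ with Tour.covers T Vx
  ... | j , j≤m , refl = Any-resp-⊆ rest⊆ (placed j≤m x≢)

  clique-inj : ∀ {x} (Z : Vec (Fin M) r) → IsClique (λ y y′ → E G (x , ι y) (x , ι y′)) Z →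
    Injective _≡_ _≡_ (lookup Z)
  clique-inj {x} Z clique {y} {y′} eq with y Fin.≟ y′
  ... | yes p = p
  ... | no ≢  = contradiction (cong (λ z → x , ι z) eq) (edge-distinct G (clique y y′ ≢))

  some-u : ∃ (_∈ U)
  some-u with U | U-large
  ... | u ∷ _ | _ = u , here refl

  -- Rows adjacent in some column are distinct; as `K-Y` speaks of columns in `U`, a member of `U`
  -- is needed.
  K≢Y : ∀ i j → lookup K i ≢ lookup Y j
  K≢Y i j eq = edge-distinct G (K-Y (proj₂ some-u) i j) (cong (λ z → proj₁ some-u , ι z) eq)

  ψ-inj : Injective _≡_ _≡_ ψ
  ψ-inj {y} {y′} eq with V H (x₀ , y) | V H (x₀ , y′)
  ... | true  | true  = clique-inj Y Y-clique eq
  ... | true  | false = contradiction (sym eq) (K≢Y y′ y)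
  ... | false | true  = contradiction eq (K≢Y y y′)
  ... | false | false = clique-inj K (K-clique (proj₂ some-u)) eq

  v-row : ∀ {u} → u ∈ U → ∀ y → E G (v , ι (ψ y)) (u , ι (ψ y)) ≡ true
  v-row u∈ y with V H (x₀ , y)
  ... | true  = Y-row u∈ y
  ... | false = K-row u∈ y

  from-x₀ : ∀ {x y} → E H (x₀ , y) (x , y) ≡ true → E G (φ x₀ , ι (ψ y)) (φ x , ι (ψ y)) ≡ true
  from-x₀ {x} {y} e = subst (λ z → E G (z , ι (ψ y)) (φ x , ι (ψ y)) ≡ true) (sym φ-x₀)
    (v-row (in-U (proj₂ (E-V H _ _ e)) (λ x≡ → edge-distinct H e (cong (_, y) (sym x≡)))) y)

  consecutive : ∀ {j x x′ y} → j < m → w j ≡ (x , y) → w (suc j) ≡ (x′ , y) → x ≢ x₀ → x′ ≢ x₀ →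
    E G (φ x , ι (ψ y)) (φ x′ , ι (ψ y)) ≡ true
  consecutive {j} j<m eq eq′ x≢ x′≢ with edges {j} j<m
  ... | joined rewrite eq | eq′ = joined x≢ x′≢ λ { refl →
    edge-distinct H (Tour.edge T j) (trans eq (sym eq′)) }

  horizontal : ∀ {x x′ y} → E H (x , y) (x′ , y) ≡ true → E G (φ x , ι (ψ y)) (φ x′ , ι (ψ y)) ≡ true
  horizontal {x} {x′} {y} e with x Fin.≟ x₀ | x′ Fin.≟ x₀
  ... | yes refl | _        = from-x₀ e
  ... | no _     | yes refl = E-sym G _ _ (from-x₀ (E-sym H _ _ e))
  ... | no x≢    | no x′≢ with Tour.edges T e
  ...   | j , j≤m , ends with m≤n⇒m<n∨m≡n j≤m | ends
  -- `Grown` covers the steps before `m` only, but the closing edge has an end in column `x₀`, which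
  -- is excluded here.
  ...     | inj₂ refl | inj₁ (_ , eq) = contradiction (cong col (trans eq (Tour.period T 0))) x′≢
  ...     | inj₂ refl | inj₂ (eq , _) = contradiction (cong col (trans eq (Tour.period T 0))) x≢
  ...     | inj₁ j<m  | inj₁ (eq , eq′) = consecutive j<m (sym eq) (sym eq′) x≢ x′≢
  ...     | inj₁ j<m  | inj₂ (eq , eq′) = E-sym G _ _ (consecutive j<m (sym eq′) (sym eq) x′≢ x≢)

  vertical : ∀ {x y y′} → E H (x , y) (x , y′) ≡ true → E G (φ x , ι (ψ y)) (φ x , ι (ψ y′)) ≡ true
  vertical {x} {y} {y′} e with x Fin.≟ x₀
  ... | yes refl rewrite φ-x₀ | proj₁ (E-V H _ _ e) | proj₂ (E-V H _ _ e) =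
    Y-clique y y′ λ { refl → edge-distinct H e refl }
  ... | no x≢ with V H (x₀ , y) in p | V H (x₀ , y′) in q | in-U (proj₁ (E-V H _ _ e)) x≢
  -- An edge between two rows of `Y` in a column of `U` is the one kind the skeleton does not
  -- provide.
  ...   | true  | true  | _  = ⊥-elim (good x≢ e p q)
  ...   | true  | false | u∈ = E-sym G _ _ (K-Y u∈ y′ y)
  ...   | false | true  | u∈ = K-Y u∈ y y′
  ...   | false | false | u∈ = K-clique u∈ y y′ λ { refl → edge-distinct H e refl }

  embedding : Contains G H
  embedding = record
    { φc = φ ; φr = ι ∘ ψ ; φc-inj = injective ; φr-inj = ψ-inj ∘ ι-inj ; edges = edges′ }
    where
    edges′ : ∀ x y x′ y′ → E H (x , y) (x′ , y′) ≡ true →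
      E G (φ x , ι (ψ y)) (φ x′ , ι (ψ y′)) ≡ true
    edges′ x y x′ y′ e with E-grid H _ _ e
    ... | inj₁ refl = horizontal e
    ... | inj₂ refl = vertical e

-- Cocliques

Coclique : ℕ → Graph X → Set
Coclique k g = ∃ λ (f : Fin k → _) → ∀ i j → i ≢ j → f i ≢ f j × g (f i) (f j) ≡ false

any-Vec? : ∀ {n} k {P : Vec (Fin n) k → Set} → (∀ v → Dec (P v)) → Dec (∃ P)
any-Vec? zero    P? = map′ ([] ,_) (λ { ([] , p) → p }) (P? [])
any-Vec? (suc k) P? = map′ (λ { (x , xs , p) → x ∷ xs , p }) (λ { (x ∷ xs , p) → x , xs , p })
  (Fin.any? λ x → any-Vec? k λ xs → P? (x ∷ xs))

-- Vectors can be searched exhaustively, functions not directly; `lookup` and `Vec.tabulate`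
-- translate. Deciding this makes the case distinction in `coclique-or-dense` constructive.
coclique? : ∀ {n} k (g : Graph (Fin n)) → Dec (Coclique k g)
coclique? k g = map′ (λ { (v , p) → lookup v , p })
  (λ { (f , p) → Vec.tabulate f , λ i j i≢j →
    subst₂ (λ a b → a ≢ b × g a b ≡ false) (sym (lookup∘tabulate f i)) (sym (lookup∘tabulate f j)) (p i j i≢j) })
  (any-Vec? k λ v → Fin.all? λ i → Fin.all? λ j → ¬? (i Fin.≟ j) →-dec
    (¬? (lookup v i Fin.≟ lookup v j) ×-dec (g (lookup v i) (lookup v j) Bool.≟ false)))

independent⇒coclique : ∀ {k} {g : Graph X} {l} → Symmetric g → Independent g l → k ≤ length l → Coclique k g
independent⇒coclique {g = g} {l} g-sym indep k≤ = f , pairs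
  where
  f = λ i → List.lookup l (Fin.inject≤ i k≤)
  ordered : ∀ {i j} → toℕ i < toℕ j → f i ≢ f j × g (f i) (f j) ≡ false
  ordered {i} {j} i<j = AllPairs-lookup indep
    (subst₂ _<_ (sym (Fin.toℕ-inject≤ i k≤)) (sym (Fin.toℕ-inject≤ j k≤)) i<j)
  pairs : ∀ i j → i ≢ j → f i ≢ f j × g (f i) (f j) ≡ false
  pairs i j i≢j with <-cmp (toℕ i) (toℕ j)
  ... | tri< i<j _ _ = ordered i<j
  ... | tri≈ _ eq _  = contradiction (Fin.toℕ-injective eq) i≢j
  ... | tri> _ _ j<i = let ≢ , no-edge = ordered j<i in
    ≢ ∘ sym , Bool.¬-not λ e → case trans (sym (g-sym e)) no-edge of λ ()

no-coclique⇒independenceBelow : ∀ {k} {g : Graph X} → Symmetric g → ¬ Coclique k g → IndependenceBelow k g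
no-coclique⇒independenceBelow {k = k} g-sym none {l} indep with length l <? k
... | yes lt = lt
... | no ≮   = contradiction (independent⇒coclique g-sym indep (≮⇒≥ ≮)) none

coclique-inj : ∀ {k} {g : Graph X} (C : Coclique k g) → Injective _≡_ _≡_ (proj₁ C)
coclique-inj (f , p) {i} {j} eq with i Fin.≟ j
... | yes i≡j = i≡j
... | no i≢j  = contradiction eq (proj₁ (p i j i≢j))

row-graph : ∀ {c r} → GridSubgraph c r → Fin r → Graph (Fin c)
row-graph G y x x′ = E G (x , y) (x′ , y)

col-graph : ∀ {c r} → GridSubgraph c r → Fin c → Graph (Fin r)
col-graph G x y y′ = E G (x , y) (x , y′)

coclique-or-dense : ∀ {c r} (G : GridSubgraph c r) → Spanning G → ∀ k → HasCoclique G k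
  ⊎ (∀ y → IndependenceBelow k (row-graph G y)) × (∀ x → IndependenceBelow k (col-graph G x))
coclique-or-dense G spanning k
  with Fin.any? (λ y → coclique? k (row-graph G y)) | Fin.any? (λ x → coclique? k (col-graph G x))
... | yes (y , C@(f , p)) | _ =
  inj₁ (inj₁ (y , f , coclique-inj {g = row-graph G y} C , (λ _ → spanning _) , λ i j i≢j → proj₂ (p i j i≢j)))
... | no _ | yes (x , C@(f , p)) =
  inj₁ (inj₂ (x , f , coclique-inj {g = col-graph G x} C , (λ _ → spanning _) , λ i j i≢j → proj₂ (p i j i≢j)))
... | no ¬row | no ¬col = inj₂
  ( (λ y → no-coclique⇒independenceBelow (E-sym G _ _) λ C → ¬row (y , C))
  , (λ x → no-coclique⇒independenceBelow (E-sym G _ _) λ C → ¬col (x , C)))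

independenceBelow-restrict : ∀ {Z : Set} {k} {g : Graph X} (f : Z → X) → Injective _≡_ _≡_ f →
  IndependenceBelow k g → IndependenceBelow k (λ a b → g (f a) (f b))
independenceBelow-restrict {k = k} f f-inj α<k {l} indep = subst (_< k) (List.length-map f l)
  (α<k (AllPairs.map⁺ (AllPairs.map (λ { (≢ , p) → ≢ ∘ f-inj , p }) indep)))

-- Bounds

double-power : ∀ {k} → 2 ≤ k → ∀ n → k ^ n + k ^ n ≤ k ^ suc n
double-power {k} 2≤k n = begin
  k ^ n + k ^ n ≡⟨ cong (k ^ n +_) (+-identityʳ _) ⟨
  2 * k ^ n     ≤⟨ *-monoˡ-≤ _ 2≤k ⟩
  k * k ^ n     ∎
  where open ≤-Reasoning

-- Absorbs the constants that depend on the cycle into the exponent, using `2 ≤ k`.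
n≤k^n : ∀ {k} → 2 ≤ k → ∀ n → n ≤ k ^ n
n≤k^n 2≤k zero = z≤n
n≤k^n {k} 2≤k (suc n) = ≤-trans
  (+-mono-≤ (m^n>0 k {{>-nonZero (<⇒≤ 2≤k)}} n) (n≤k^n 2≤k n)) (double-power 2≤k n)

good-column⇒inPGR : ∀ {c r m} {H : GridSubgraph c r} {w} → Tour H m w → Simple H → GoodCol H (col (w 0)) → InPGR H
good-column⇒inPGR {c} {r} {m} {H} T simple good = C , bound
  where
  s e C : ℕ
  -- One more than the exponent of the threshold for `M`: 2 for the pairs of columns, `r` for each
  -- of the two cliques.
  s = suc (2 + (r + (r + 0)))
  -- Each pigeonhole costs `M ^ r`, that is `k ^ (s * r)`; the last summand bounds `c + m * k`.
  e = s * r + (s * r + suc (c + m))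
  -- One `suc` is the factor `k` for the degree of `v`, the other absorbs the added 1; `s` ensures
  -- `M ≤ N`.
  C = s + suc (suc e)
  bound : ∀ k → 2 ≤ k → GrBound H k (k ^ C)
  bound k 2≤k = N , ≤-refl , ramsey
    where
    open ≤-Reasoning
    M N : ℕ
    M = k ^ s
    N = k ^ C
    1≤k : 1 ≤ k
    1≤k = <⇒≤ 2≤k
    instance
      k≢0 : NonZero k
      k≢0 = >-nonZero 1≤k
    M≤N : M ≤ N
    M≤N = ^-monoʳ-≤ k (m≤m+n s _)
    M-large : k ^ 2 * (k ^ r * (k ^ r * 1)) < M
    M-large = begin-strict
      k ^ 2 * (k ^ r * (k ^ r * k ^ 0)) ≡⟨ cong (λ z → k ^ 2 * (k ^ r * z)) (^-distribˡ-+-* k r 0) ⟨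
      k ^ 2 * (k ^ r * k ^ (r + 0))     ≡⟨ cong (k ^ 2 *_) (^-distribˡ-+-* k r (r + 0)) ⟨
      k ^ 2 * k ^ (r + (r + 0))         ≡⟨ ^-distribˡ-+-* k 2 (r + (r + 0)) ⟨
      k ^ (2 + (r + (r + 0)))           <⟨ ^-monoʳ-< k 2≤k {2 + (r + (r + 0))} ≤-refl ⟩
      k ^ s                             ∎
    q≤ : c + m * k ≤ k ^ suc (c + m)
    q≤ = begin
      c + m * k           ≤⟨ +-monoˡ-≤ _ (m≤m*n c k) ⟩
      c * k + m * k       ≡⟨ *-distribʳ-+ k c m ⟨
      (c + m) * k         ≡⟨ *-comm (c + m) k ⟩
      k * (c + m)         ≤⟨ *-monoʳ-≤ k (n≤k^n 2≤k (c + m)) ⟩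
      k * k ^ (c + m)     ∎
    times-M^r : ∀ {a} n → a ≤ k ^ n → M ^ r * a ≤ k ^ (s * r + n)
    times-M^r {a} n a≤ = begin
      M ^ r * a             ≡⟨ cong (_* a) (^-*-assoc k s r) ⟩
      k ^ (s * r) * a       ≤⟨ *-monoʳ-≤ (k ^ (s * r)) a≤ ⟩
      k ^ (s * r) * k ^ n   ≡⟨ ^-distribˡ-+-* k (s * r) n ⟨
      k ^ (s * r + n)       ∎
    N-large : k * suc (M ^ r * (M ^ r * (c + m * k))) ≤ N
    N-large = begin
      k * suc (M ^ r * (M ^ r * (c + m * k))) ≤⟨ *-monoʳ-≤ k (+-mono-≤ (m^n>0 k e)
                                                   (times-M^r _ (times-M^r _ q≤))) ⟩
      k * (k ^ e + k ^ e)                     ≤⟨ *-monoʳ-≤ k (double-power 2≤k e) ⟩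
      k ^ suc (suc e)                         ≤⟨ ^-monoʳ-≤ k (m≤n+m _ s) ⟩
      k ^ C                                   ∎
    ι : Fin M → Fin N
    ι y = Fin.inject≤ y M≤N
    ι-inj : Injective _≡_ _≡_ ι
    ι-inj = Fin.inject≤-injective M≤N M≤N _ _
    ramsey : (G : GridSubgraph N N) → Spanning G → Contains G H ⊎ HasCoclique G k
    ramsey G spanning with coclique-or-dense G spanning k
    ... | inj₁ coclique = inj₂ coclique
    ... | inj₂ (α-row , α-col) = inj₁ (Embed.embedding T simple good 1≤k G ι ι-inj (α-row ∘ ι)
      (skeleton 1≤k _ _ (α-row ∘ ι) (λ x → independenceBelow-restrict ι ι-inj (α-col x))
        (λ _ → E-sym G _ _) r (c + m * k) M-large N-large))

visited-good-column⇒inPGR : ∀ {c r m} {H : GridSubgraph c r} {w} → Tour H m w → Simple H →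
  ∀ {u} → V H u ≡ true → GoodCol H (col u) → InPGR H
visited-good-column⇒inPGR {H = H} {w} T simple Vu good with Tour.covers T Vu
... | b , _ , refl with rotate b T
...   | w′ , T′ , eq = good-column⇒inPGR T′ simple
  (subst (GoodCol H ∘ col) (sym (trans (eq 0) (cong w (+-identityʳ b)))) good)

theorem1p1 : ∀ {c r} (H : GridSubgraph c r) (n : ℕ) →
    IsSimpleCycle H n → 5 ≤ n → InPGR H
theorem1p1 H (suc m) (cycle , simple) (s≤s 4≤m) with cycle⇒tour cycle
... | w , T with good-column-or-row T simple (λ { refl → <⇒≱ (n<1+n 3) 4≤m })
...   | inj₁ (_ , Vu , good) = visited-good-column⇒inPGR T simple Vu good
...   | inj₂ (_ , Vu , good) with transpose-simpleCycle (cycle , simple)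
...     | cycle′ , simple′ = transpose-inPGR
  (visited-good-column⇒inPGR (proj₂ (cycle⇒tour cycle′)) simple′ Vu good)
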